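{- Governed bisimilarity and strong direct simulation equivalence are incomparable: there is a parity game with vertices $v,w$ that are governed bisimilar but not strong direct simulation equivalent, and there is a parity game with vertices $v,w$ that are strong direct simulation equivalent but not governed bisimilar.
   Context: A parity game is a tuple $(V,\to,\Omega,\mathcal P)$ where $V$ is a finite set of vertices, $\to\subseteq V\times V$ is total (every vertex has at least one successor), $\Omega:V\to\mathbb N$ is a priority function, and $\mathcal P:V\to\{\Diamond,\Box\}$ assigns each vertex to player even ($\Diamond$) or odd ($\Box$). Write $V_\Diamond,V_\Box$ for the vertices owned by each player and $v^\bullet=\{w\mid v\to w\}$. Governed bisimilarity: a symmetric $R\subseteq V\times V$ is a governed bisimulation iff $v\,R\,w$ implies: (1) $\Omega(v)=\Omega(w)$; (2) if $\mathcal P(v)\neq\mathcal P(w)$, then $v'\,R\,w'$ for all $v'\in v^\bullet$, $w'\in w^\bullet$; (3) for all $v'\in v^\bullet$ there is $w'\in w^\bullet$ with $v'\,R\,w'$. Vertices are governed bisimilar iff some governed bisimulation relates them. Strong direct simulation equivalence: $v\to_i T$ (one-step forcing) means: either $\mathcal P(v)=i$ and $v^\bullet\cap T\neq\emptyset$, or $\mathcal P(v)\neq i$ and $v^\bullet\subseteq T$. Put $vR=\{w\mid v\,R\,w\}$, $UR=\bigcup_{u\in U}uR$. $R\subseteq V\times V$ is a direct simulation iff $v\,R\,w$ implies $\Omega(v)=\Omega(w)$; if $v\in V_\Diamond$ then $w\to_\Diamond v'R$ for each $v'\in v^\bullet$; if $v\in V_\Box$ then $w\to_\Diamond v^\bullet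 R$. A strong direct simulation is a direct simulation that only relates vertices with the same owner. $v\leq_{sd}w$ iff some strong direct simulation relates $v$ to $w$; $v,w$ are strong direct simulation equivalent iff $v\leq_{sd}w$ and $w\leq_{sd}v$. -}

module Defs where

open import Data.Fin.Base using (Fin)
open import Data.Nat.Base using (ℕ)
open import Data.Product.Base using (_×_; ∃; ∃-syntax)
open import Data.Sum.Base using (_⊎_)
open import Function.Bundles using (_↔_)
open import Level using (0ℓ)
open import Relation.Binary.Core using (Rel)
open import Relation.Binary.Definitions using (Decidable; Symmetric)
open import Relation.Binary.PropositionalEquality.Core using (_≡_; _≢_)
open import Relation.Unary using (Pred; _∈_; _⊆_; _≬_)

data Player : Set where
  ◇ □ : Player

record ParityGame : Set₁ where
  infix 4 _⟶_
  field
    V      : Set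
    finite : ∃[ n ] (V ↔ Fin n)
    _⟶_    : Rel V 0ℓ
    -- Decidability makes _⟶_ a subset of the finite set V × V in the usual
    -- classical sense.
    _⟶?_   : Decidable _⟶_
    total  : ∀ v → ∃[ w ] v ⟶ w
    Ω      : V → ℕ
    owner  : V → Player

  infix 9 _∙
  _∙ : V → Pred V 0ℓ
  (v ∙) w = v ⟶ w

  -- v ⊩[ i ] T: player i can force the play from v into T in one step.
  infix 4 _⊩[_]_
  _⊩[_]_ : V → Player → Pred V 0ℓ → Set
  v ⊩[ i ] T = (owner v ≡ i × v ∙ ≬ T) ⊎ (owner v ≢ i × v ∙ ⊆ T)

  -- U ⟪ R ⟫ is the union of the sets uR over u ∈ U; the set vR itself is
  -- the partial application R v.
  infix 8 _⟪_⟫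
  _⟪_⟫ : Pred V 0ℓ → Rel V 0ℓ → Pred V 0ℓ
  (U ⟪ R ⟫) w = ∃[ u ] (u ∈ U × w ∈ R u)

module _ (G : ParityGame) where
  open ParityGame G

  record IsGovernedBisimulation (R : Rel V 0ℓ) : Set where
    field
      symmetric : Symmetric R
      priority  : ∀ {v w} → R v w → Ω v ≡ Ω w
      governed  : ∀ {v w} → R v w → owner v ≢ owner w →
                  ∀ v′ w′ → v′ ∈ v ∙ → w′ ∈ w ∙ → R v′ w′
      transfer  : ∀ {v w} → R v w →
                  ∀ v′ → v′ ∈ v ∙ → ∃[ w′ ] (w′ ∈ w ∙ × R v′ w′)

  GovernedBisimilar : V → V → Set₁
  GovernedBisimilar v w = ∃[ R ] (IsGovernedBisimulation R × R v w)

  -- The forcing player is ◇ in both simulation clauses.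
  record IsDirectSimulation (R : Rel V 0ℓ) : Set where
    field
      priority : ∀ {v w} → R v w → Ω v ≡ Ω w
      even     : ∀ {v w} → R v w → owner v ≡ ◇ →
                 ∀ v′ → v′ ∈ v ∙ → w ⊩[ ◇ ] R v′
      odd      : ∀ {v w} → R v w → owner v ≡ □ →
                 w ⊩[ ◇ ] v ∙ ⟪ R ⟫

  record IsStrongDirectSimulation (R : Rel V 0ℓ) : Set where
    field
      isDirectSimulation : IsDirectSimulation R
      sameOwner          : ∀ {v w} → R v w → owner v ≡ owner w

  StronglyDirectlySimulatedBy : V → V → Set₁
  StronglyDirectlySimulatedBy v w =
    ∃[ R ] (IsStrongDirectSimulation R × R v w)

  StrongDirectSimulationEquivalent : V → V → Set₁
  StrongDirectSimulationEquivalent v w =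
    StronglyDirectlySimulatedBy v w × StronglyDirectlySimulatedBy w v

{-# OPTIONS --safe #-}
-- Complementary weaknesses separate the two relations.  Governed bisimilarity
-- ignores ownership among vertices whose successors are all related, whereas
-- strong direct simulations respect owners.  Conversely, when ◇ owns every
-- vertex, governed bisimilarity and strong direct simulation equivalence become
-- ordinary bisimilarity and simulation equivalence, so the classical example
-- separating these two (an extra successor that is strictly simulated by another
-- one) applies.
module Submission where

open import Defs
open import Data.Fin.Base using (Fin)
open import Data.Fin.Patterns
open import Data.Fin.Properties using (_≟_)
open import Data.List.Base using (List; []; _∷_)
open import Data.List.Membership.DecPropositional using (_∈?_)
open import Data.List.Membership.Propositional using (_∈_)
open import Data.List.Relation.Unary.Any using (here; there)
open import Data.Product.Base using (Σ-syntax; _×_; _,_; ∃-syntax)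
open import Data.Sum.Base using (inj₁)
open import Data.Unit.Base using (⊤; tt)
open import Function.Construct.Identity using (↔-id)
open import Level using (0ℓ)
open import Relation.Binary.Core using (Rel)
open import Relation.Binary.PropositionalEquality.Core using (_≡_; refl; sym; trans)
open import Relation.Nullary.Decidable.Core using (yes)
open import Relation.Nullary.Negation.Core using (¬_)

module _ (G : ParityGame) where
  open ParityGame G

  -- When `◇` makes every move, forcing a set in one step just means having a successor in it, so
  -- matching single moves suffices.
  ◇-owned-simulation : {R : Rel V 0ℓ} →
    (∀ v → owner v ≡ ◇) →
    (∀ {v w} → R v w → Ω v ≡ Ω w) →
    (∀ {v w v′} → R v w → v ⟶ v′ → ∃[ w′ ] (w ⟶ w′ × R v′ w′)) →
    IsStrongDirectSimulation G R
  ◇-owned-simulation own prio step = record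
    { isDirectSimulation = record
      { priority = prio
      ; even     = λ {_} {w} vRw _ v′ v⟶v′ → inj₁ (own w , step vRw v⟶v′)
      -- Totality provides a move of `v`; its match lands in `v ∙ ⟪ R ⟫`.
      ; odd      = λ {v} {w} vRw _ →
          let v′ , v⟶v′        = total v
              w′ , w⟶w′ , v′Rw′ = step vRw v⟶v′
          in inj₁ (own w , w′ , w⟶w′ , v′ , v⟶v′ , v′Rw′)
      }
    ; sameOwner = λ {v} {w} _ → trans (own v) (sym (own w))
    }

completeGame : ParityGame
completeGame = record
  { V      = Fin 2
  ; finite = 2 , ↔-id _
  ; _⟶_    = λ _ _ → ⊤
  ; _⟶?_   = λ _ _ → yes tt
  ; total  = λ v → v , tt
  ; Ω      = λ _ → 0
  ; owner  = λ { 0F → ◇ ; 1F → □ }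
  }

-- Priorities are constant, so the full relation qualifies despite the differing owners.
governedBisimilar : GovernedBisimilar completeGame 0F 1F
governedBisimilar = (λ _ _ → ⊤) , record
  { symmetric = λ _ → tt
  ; priority  = λ _ → refl
  ; governed  = λ _ _ _ _ _ _ → tt
  ; transfer  = λ _ v′ _ → v′ , tt , tt
  } , tt

¬strongEquivalent : ¬ StrongDirectSimulationEquivalent completeGame 0F 1F
¬strongEquivalent ((_ , isSim , 0R1) , _)
  with () ← IsStrongDirectSimulation.sameOwner isSim 0R1

pattern p = 0F
pattern q = 1F
pattern b = 2F
pattern c = 3F

-- `q` may loop or exit to `c`, while `b` loops forever; `p` behaves like `q` with an extra move
-- into `b`.
successors : Fin 4 → List (Fin 4)
successors p = p ∷ b ∷ c ∷ []
successors q = q ∷ c ∷ []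
successors b = b ∷ []
successors c = c ∷ []

◇-game : ParityGame
◇-game = record
  { V      = Fin 4
  ; finite = 4 , ↔-id _
  ; _⟶_    = λ x y → y ∈ successors x
  ; _⟶?_   = λ x y → _∈?_ _≟_ y (successors x)
  ; total  = λ { p → p , here refl
               ; q → q , here refl
               ; b → b , here refl
               ; c → c , here refl }
  ; Ω      = λ { c → 1 ; _ → 0 }
  ; owner  = λ _ → ◇
  }

open ParityGame ◇-game using (_⟶_; Ω)

infix 4 _≼_
-- Relating `p` and `q` both ways lets one relation witness both halves of the equivalence. `b ≼ q`
-- has no converse, since `b` cannot exit to `c`.
data _≼_ : Rel (Fin 4) 0ℓ where
  p≼q : p ≼ q
  q≼p : q ≼ p
  b≼q : b ≼ q
  b≼b : b ≼ b
  c≼c : c ≼ c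

≼-priority : ∀ {x y} → x ≼ y → Ω x ≡ Ω y
≼-priority p≼q = refl
≼-priority q≼p = refl
≼-priority b≼q = refl
≼-priority b≼b = refl
≼-priority c≼c = refl

≼-step : ∀ {x y x′} → x ≼ y → x ⟶ x′ → ∃[ y′ ] (y ⟶ y′ × x′ ≼ y′)
≼-step p≼q (here refl)                 = q , here refl , p≼q
-- The extra move of `p` is absorbed by the loop at `q`, which can imitate `b` forever.
≼-step p≼q (there (here refl))         = q , here refl , b≼q
≼-step p≼q (there (there (here refl))) = c , there (here refl) , c≼c
≼-step q≼p (here refl)                 = p , here refl , q≼p
≼-step q≼p (there (here refl))         = c , there (there (here refl)) , c≼c
≼-step b≼q (here refl)                 = q , here refl , b≼q
≼-step b≼b (here refl)                 = b , here refl , b≼b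
≼-step c≼c (here refl)                 = c , here refl , c≼c

strongEquivalent : StrongDirectSimulationEquivalent ◇-game p q
strongEquivalent = (_≼_ , isSim , p≼q) , (_≼_ , isSim , q≼p)
  where
  isSim : IsStrongDirectSimulation ◇-game _≼_
  isSim = ◇-owned-simulation ◇-game (λ _ → refl) ≼-priority ≼-step

-- The successor b of p can only be matched by q, but then the move from q to
-- c, the only vertex of priority 1, has no match from b.
¬governedBisimilar : ¬ GovernedBisimilar ◇-game p q
¬governedBisimilar (R , isBisim , pRq) = go (transfer pRq b (there (here refl)))
  where
  open IsGovernedBisimulation isBisim

  ¬bRc : ¬ R b c
  ¬bRc bRc with () ← priority bRc

  ¬bRq : ¬ R b q
  ¬bRq bRq with transfer (symmetric bRq) c (there (here refl))
  ... | _ , here refl , cRb = ¬bRc (symmetric cRb)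

  go : ¬ (∃[ y ] (q ⟶ y × R b y))
  go (_ , here refl         , bRq) = ¬bRq bRq
  go (_ , there (here refl) , bRc) = ¬bRc bRc

theorem22 : (Σ[ G ∈ ParityGame ] Σ[ v ∈ ParityGame.V G ] Σ[ w ∈ ParityGame.V G ]
    (GovernedBisimilar G v w × ¬ StrongDirectSimulationEquivalent G v w))
    ×
    (Σ[ G ∈ ParityGame ] Σ[ v ∈ ParityGame.V G ] Σ[ w ∈ ParityGame.V G ]
    (StrongDirectSimulationEquivalent G v w × ¬ GovernedBisimilar G v w))
theorem22 =
    (completeGame , 0F , 1F , governedBisimilar , ¬strongEquivalent)
  , (◇-game , p , q , strongEquivalent , ¬governedBisimilar)
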